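{- If $A$ is an acyclic type and $B$ is a family of acyclic types over $A$, then the dependent sum $\sum_{a : A} B(a)$ is acyclic.
   Context: We work in homotopy type theory (HoTT) in the style of the HoTT Book: dependent type theory with univalent universes (hence function extensionality) and higher inductive types such as pushouts; no classical axioms are assumed. The suspension $\Sigma A$ of a type $A$ is the pushout of $\mathbf{1} \leftarrow A \to \mathbf{1}$. A type is acyclic if its suspension is contractible. -}

{-# OPTIONS --without-K #-}
-- Without K, `_≡_` is the identity type of homotopy type theory.  Plain
-- Martin-Löf type theory has no higher inductive types, so the rules for
-- pushouts are packaged as a record, to be taken as a hypothesis.  Univalence
-- and function extensionality are not assumed; what holds here therefore holds
-- a fortiori in univalent type theory.
module Defs where

open import Level using (Level; _⊔_; Setω)
open import Data.Product using (Σ)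
open import Data.Unit using (⊤; tt)
open import Relation.Binary.PropositionalEquality using (_≡_; subst; trans; cong; dcong)

-- The pushout of the span B ← A → C as a higher inductive type, eliminating into
-- every universe.  A hypothesis cannot impose judgmental equalities, so the
-- computation rules on points are identifications too, and `ind-glue` states
-- `dcong (ind P l r h) (glue x) ≡ h x` up to transport along them.
record HITPushout {a b c} {A : Set a} {B : Set b} {C : Set c}
                  (f : A → B) (g : A → C) : Setω where
  field
    Pushout : Set (a ⊔ b ⊔ c)

    inl  : B → Pushout
    inr  : C → Pushout
    glue : ∀ x → inl (f x) ≡ inr (g x)

    ind : ∀ {p} (P : Pushout → Set p)
          (l : ∀ y → P (inl y)) (r : ∀ z → P (inr z)) →
          (∀ x → subst P (glue x) (l (f x)) ≡ r (g x)) →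
          ∀ w → P w

    ind-inl  : ∀ {p} (P : Pushout → Set p) l r h y → ind P l r h (inl y) ≡ l y
    ind-inr  : ∀ {p} (P : Pushout → Set p) l r h z → ind P l r h (inr z) ≡ r z
    ind-glue : ∀ {p} (P : Pushout → Set p) l r h x →
               trans (dcong (ind P l r h) (glue x)) (ind-inr P l r h (g x)) ≡
               trans (cong (subst P (glue x)) (ind-inl P l r h (f x))) (h x)

Pushouts : Setω
Pushouts = ∀ {a b c} {A : Set a} {B : Set b} {C : Set c}
           (f : A → B) (g : A → C) → HITPushout f g

isContr : ∀ {a} → Set a → Set a
isContr A = Σ A λ x → ∀ y → x ≡ y

module _ (pushouts : Pushouts) where

  Susp : ∀ {a} → Set a → Set a
  Susp A = HITPushout.Pushout (pushouts {A = A} {B = ⊤} {C = ⊤} (λ _ → tt) (λ _ → tt))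

  IsAcyclic : ∀ {a} → Set a → Set a
  IsAcyclic A = isContr (Susp A)

{-# OPTIONS --safe #-}
{-# OPTIONS --without-K #-}
-- A type A is acyclic iff every family of paths p : A → x ≡ y, in any type, is
-- constant, meaning that p a ≡ q for some q : x ≡ y and all a.  If A is acyclic,
-- the map ΣA → X induced by p factors through a contractible type, where all
-- meridians agree; conversely, constancy of the family of meridians contracts ΣA.
-- The criterion passes to Σ A B by applying it first in B x and then in A.
module Submission where

open import Data.Product using (Σ; _,_; proj₁; proj₂)
open import Data.Unit using (⊤; tt)
open import Relation.Binary.PropositionalEquality
  using (_≡_; refl; sym; trans; cong; dcong; subst)
open import Relation.Binary.PropositionalEquality.Properties
  using (trans-symˡ; trans-reflʳ)
open import Defs

ConstantPaths : ∀ {a x} (A : Set a) (X : Set x) → Set _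
ConstantPaths A X =
  ∀ {x y : X} (p : A → x ≡ y) → Σ (x ≡ y) λ q → ∀ a → p a ≡ q

Σ-constantPaths : ∀ {a b x} {A : Set a} {B : A → Set b} {X : Set x} →
  ConstantPaths A X → (∀ x → ConstantPaths (B x) X) → ConstantPaths (Σ A B) X
Σ-constantPaths cA cB p =
  let fibre = λ x → cB x (λ y → p (x , y))
      q , q-const = cA (λ x → proj₁ (fibre x))
  in q , λ (x , y) → trans (proj₂ (fibre x) y) (q-const x)

-- As `p` does not occur on the right, this gives all parallel paths one explicit common value.
isContr⇒paths-const : ∀ {a} {A : Set a} ((c , h) : isContr A) {x y : A} (p : x ≡ y) →
  p ≡ trans (sym (h x)) (h y)
isContr⇒paths-const (c , h) {x} refl = sym (trans-symˡ (h x))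

subst-const : ∀ {a b} {A : Set a} {B : Set b} {x y : A} (p : x ≡ y) {z : B} →
  subst (λ _ → B) p z ≡ z
subst-const refl = refl

subst-paths-from : ∀ {a} {A : Set a} {x y z : A} (p : y ≡ z) (q : x ≡ y) →
  subst (x ≡_) p q ≡ trans q p
subst-paths-from refl q = sym (trans-reflʳ q)

-- Turns `ind-glue` for a constant family into the computation rule of `cong`.
dcong-const⇒cong : ∀ {a b} {A : Set a} {B : Set b} (f : A → B)
  {x y : A} (p : x ≡ y) {u v : B} (l : f x ≡ u) (r : f y ≡ v) (e : u ≡ v) →
  trans (dcong f p) r ≡ trans (cong (subst (λ _ → B) p) l) (trans (subst-const p) e) →
  e ≡ trans (sym l) (trans (cong f p) r)
dcong-const⇒cong f refl refl r e eq = sym eq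

module _ (pushouts : Pushouts) where

  module Suspension {a} (A : Set a) =
    HITPushout (pushouts {A = A} {B = ⊤} {C = ⊤} (λ _ → tt) (λ _ → tt))

  acyclic⇒constantPaths : ∀ {a x} {A : Set a} {X : Set x} →
    IsAcyclic pushouts A → ConstantPaths A X
  acyclic⇒constantPaths {A = A} {X} (c , h) {x} {y} p =
    through (trans (sym (h (inl tt))) (h (inr tt))) , λ a →
      -- First `p a ≡ through (glue a)`, then `glue a` is replaced by the canonical path between the
      -- poles.
      trans (dcong-const⇒cong f (glue a) βl βr (p a) (ind-glue P l r g a))
            (cong through (isContr⇒paths-const (c , h) (glue a)))
    where
    open Suspension A
    P = λ (_ : Pushout) → X
    l = λ (_ : ⊤) → x
    r = λ (_ : ⊤) → y
    g = λ a → trans (subst-const (glue a)) (p a)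
    f = ind P l r g
    βl = ind-inl P l r g tt
    βr = ind-inr P l r g tt

    -- `f` sends the poles to `x` and `y` only up to `βl` and `βr`, hence the conjugation.
    through : inl tt ≡ inr tt → x ≡ y
    through m = trans (sym βl) (trans (cong f m) βr)

  constantPaths⇒acyclic : ∀ {a} {A : Set a} →
    ConstantPaths A (Susp pushouts A) → IsAcyclic pushouts A
  constantPaths⇒acyclic {A = A} cA =
    let q , q-const = cA glue in
    -- The south pole is reached along `q`; coherence over the meridian at `a` then amounts to
    -- `glue a ≡ q`.
    inl tt , ind (inl tt ≡_) (λ _ → refl) (λ _ → q)
      λ a → trans (subst-paths-from (glue a) refl) (q-const a)
    where open Suspension A

proposition2p12 : (pushouts : Pushouts) →
    ∀ {a b} (A : Set a) (B : A → Set b) →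
    IsAcyclic pushouts A →
    (∀ x → IsAcyclic pushouts (B x)) →
    IsAcyclic pushouts (Σ A B)
proposition2p12 pushouts A B acA acB =
  constantPaths⇒acyclic pushouts
    (Σ-constantPaths (acyclic⇒constantPaths pushouts acA)
                     (λ x → acyclic⇒constantPaths pushouts (acB x)))
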